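{- Let $\epsilon\ge 0$. Consider the following greedy algorithm on an asymmetric pseudometric space $(U,d)$ with $|U|=n$ and integer $k\ge 2$: pick an arbitrary $v\in U$ and set $S=\{v\}$; while $|S|<k$, add to $S$ a point $v\in\arg\max_{u\in U} d_{\min}(u,S)$. On every $\epsilon$-symmetric instance, this algorithm returns a set $S$ with $\operatorname{div}(S)\ge \frac{R^*}{2+\epsilon}$ (a $\frac{1}{2+\epsilon}$-approximation), and it can be implemented to run in $O(kn)$ time. Moreover, there exist $\epsilon$-symmetric instances on which this algorithm (for some admissible choice of its arbitrary initial point) does not achieve a performance ratio better than $\frac{1}{2+\epsilon}$.
   Context: An asymmetric pseudometric space $(U,d)$ is a finite set $U$ with $d:U\times U\to\mathbb{R}_{\ge 0}$ such that $d(u,u)=0$ and $d(u,v)\le d(u,w)+d(w,v)$ for all $u,v,w\in U$ ($d$ need not be symmetric). For $S\subseteq U$, $\operatorname{div}(S)=\min_{u,v\in S,\,u\ne v} d(u,v)$; $R^*$ is the maximum of $\operatorname{div}(O)$ over $O\subseteq U$ with $|O|=k$ (assumed $k\le n$ and $R^*>0$). $d_{\min}(u,v)=\min\{d(u,v),d(v,u)\}$, $d_{\max}(u,v)=\max\{d(u,v),d(v,u)\}$, and $d_{\min}(u,S)=\min_{s\in S}d_{\min}(u,s)$. The space is $\epsilon$-symmetric if $(1+\epsilon)d_{\min}(u,v)\ge d_{\max}(u,v)$ for all $u,v\in U$. -}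

module Defs where

open import Algebra.Structures using (IsCommutativeRing)
import Algebra.Construct.NaturalChoice.Max as NaturalMax
import Algebra.Construct.NaturalChoice.Min as NaturalMin
open import Data.Fin using (Fin; toℕ; fromℕ<)
open import Data.Fin.Subset using (Subset; _∈_; _∪_; ⁅_⁆; ∣_∣)
open import Data.Nat as ℕ using (ℕ; suc)
open import Data.Product using (∃-syntax; _×_)
open import Function using (flip)
open import Induction.WellFounded using (Acc)
open import Level using (Level; _⊔_) renaming (suc to lsuc)
open import Relation.Binary.Bundles using (TotalOrder)
open import Relation.Binary.Construct.Closure.ReflexiveTransitive using (Star)
import Relation.Binary.Construct.NonStrictToStrict as ToStrict
open import Relation.Binary.Core using (Rel)
open import Relation.Binary.PropositionalEquality using (_≡_; _≢_)
open import Relation.Binary.Structures using (IsDecTotalOrder)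
open import Relation.Nullary using (¬_; yes; no)
open import Relation.Unary using (Pred)

-- Plays the role of ℝ, of which only the ordered-field structure is used.
-- The inverse is total; its value at 0# is unconstrained.
record OrderedField (c ℓ₁ ℓ₂ : Level) : Set (lsuc (c ⊔ ℓ₁ ⊔ ℓ₂)) where
  infix  8 _⁻¹
  infix  8 -_
  infixl 7 _*_ _/_
  infixl 6 _+_
  infix  4 _≈_ _≤_
  field
    Carrier : Set c
    _≈_     : Rel Carrier ℓ₁
    _≤_     : Rel Carrier ℓ₂
    _+_     : Carrier → Carrier → Carrier
    _*_     : Carrier → Carrier → Carrier
    -_      : Carrier → Carrier
    _⁻¹     : Carrier → Carrier
    0#      : Carrier
    1#      : Carrier
    isCommutativeRing : IsCommutativeRing _≈_ _+_ _*_ -_ 0# 1#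
    isDecTotalOrder   : IsDecTotalOrder _≈_ _≤_
    0≉1               : ¬ (0# ≈ 1#)
    ⁻¹-cong           : ∀ {x y} → x ≈ y → x ⁻¹ ≈ y ⁻¹
    ⁻¹-inverseʳ       : ∀ x → ¬ (x ≈ 0#) → x * x ⁻¹ ≈ 1#
    +-monoˡ-≤         : ∀ {x y} z → x ≤ y → x + z ≤ y + z
    *-nonNegative     : ∀ {x y} → 0# ≤ x → 0# ≤ y → 0# ≤ x * y

  _/_ : Carrier → Carrier → Carrier
  x / y = x * y ⁻¹

  2# : Carrier
  2# = 1# + 1#

  totalOrder : TotalOrder c ℓ₁ ℓ₂
  totalOrder = record
    { isTotalOrder = IsDecTotalOrder.isTotalOrder isDecTotalOrder }

  open ToStrict _≈_ _≤_ public using (_<_)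
  open NaturalMin totalOrder public using (_⊓_)
  open NaturalMax totalOrder public using () renaming (_⊔_ to _⊔ᶠ_)

-- Programs for a random access machine with natural-number registers and
-- memory, scalar (distance-valued) registers and memory, and read access to the
-- distance matrix.  Registers are named by literals; memory cells are addressed
-- by the content of a natural-number register.  Scalars can only be moved and
-- compared, so the machine is no more powerful than the usual real RAM.
infix 4 _<ᵣ_ _≤ₛ_

data Test : Set where
  _<ᵣ_ : (i j : ℕ) → Test
  _≤ₛ_ : (x y : ℕ) → Test

data Instr : Set where
  const  : (i m : ℕ) → Instr        -- rᵢ := m
  move   : (i j : ℕ) → Instr        -- rᵢ := rⱼ
  inc    : (i : ℕ) → Instr          -- rᵢ := rᵢ + 1
  load   : (i j : ℕ) → Instr        -- rᵢ := mem[rⱼ]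
  store  : (i j : ℕ) → Instr        -- mem[rᵢ] := rⱼ
  moveₛ  : (x y : ℕ) → Instr        -- sₓ := s_y
  loadₛ  : (x j : ℕ) → Instr        -- sₓ := smem[rⱼ]
  storeₛ : (i y : ℕ) → Instr        -- smem[rᵢ] := s_y
  query  : (x i j : ℕ) → Instr      -- sₓ := d(rᵢ , rⱼ)

infixr 5 _⨾_

data Program : Set where
  instr         : Instr → Program
  skip          : Program
  _⨾_           : (p q : Program) → Program
  if_then_else_ : Test → (p q : Program) → Program
  while_loop_   : Test → (p : Program) → Program

_[_↦_] : ∀ {a} {A : Set a} → (ℕ → A) → ℕ → A → ℕ → A
(f [ i ↦ a ]) j with i ℕ.≟ j
... | yes _ = a
... | no  _ = f j

module Diversity {c ℓ₁ ℓ₂} (F : OrderedField c ℓ₁ ℓ₂) where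
  open OrderedField F

  IsMinimum : ∀ {ℓ} → Pred Carrier ℓ → Pred Carrier (c ⊔ ℓ₂ ⊔ ℓ)
  IsMinimum P m = P m × (∀ x → P x → m ≤ x)

  IsMaximum : ∀ {ℓ} → Pred Carrier ℓ → Pred Carrier (c ⊔ ℓ₂ ⊔ ℓ)
  IsMaximum P m = P m × (∀ x → P x → x ≤ m)

  record AsymmetricPseudometric (n : ℕ) : Set (c ⊔ ℓ₁ ⊔ ℓ₂) where
    field
      d           : Fin n → Fin n → Carrier
      nonNegative : ∀ u v → 0# ≤ d u v
      reflexive   : ∀ u → d u u ≈ 0#
      triangle    : ∀ u v w → d u v ≤ d u w + d w v

    dmin dmax : Fin n → Fin n → Carrier
    dmin u v = d u v ⊓ d v u
    dmax u v = d u v ⊔ᶠ d v u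

    -- div(S) = r; no r qualifies when S has fewer than two points.
    IsDiv : Subset n → Pred Carrier (c ⊔ ℓ₁ ⊔ ℓ₂)
    IsDiv S = IsMinimum λ x →
      ∃[ u ] ∃[ v ] u ∈ S × v ∈ S × u ≢ v × x ≈ d u v

    -- R* = r
    IsOptimum : ℕ → Pred Carrier (c ⊔ ℓ₁ ⊔ ℓ₂)
    IsOptimum k = IsMaximum λ x → ∃[ O ] ∣ O ∣ ≡ k × IsDiv O x

    -- d_min(u , S) = r; no r qualifies when S is empty.
    IsDistance : Fin n → Subset n → Pred Carrier (c ⊔ ℓ₁ ⊔ ℓ₂)
    IsDistance u S = IsMinimum λ x → ∃[ s ] s ∈ S × x ≈ dmin u s

    -- v ∈ argmax_{u ∈ U} d_min(u , S)
    IsFarthest : Subset n → Fin n → Set (c ⊔ ℓ₁ ⊔ ℓ₂)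
    IsFarthest S v = ∃[ r ]
      IsDistance v S r × IsMaximum (λ x → ∃[ u ] IsDistance u S x) r

    IsSymmetricUpTo : Carrier → Set ℓ₂
    IsSymmetricUpTo ε = ∀ u v → dmax u v ≤ (1# + ε) * dmin u v

    -- One iteration of the greedy loop.  The chosen point ranges over all of U,
    -- so a priori it may already belong to S.
    Step : ℕ → Rel (Subset n) (c ⊔ ℓ₁ ⊔ ℓ₂)
    Step k S T = ∣ S ∣ ℕ.< k × (∃[ v ] IsFarthest S v × T ≡ S ∪ ⁅ v ⁆)

    Reaches : ℕ → Fin n → Subset n → Set (c ⊔ ℓ₁ ⊔ ℓ₂)
    Reaches k v S = Star (Step k) ⁅ v ⁆ S

    Returns : ℕ → Fin n → Subset n → Set (c ⊔ ℓ₁ ⊔ ℓ₂)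
    Returns k v S = Reaches k v S × ¬ (∣ S ∣ ℕ.< k)

    -- Whatever ties are chosen, the run from v never gets stuck and is finite.
    AlwaysTerminates : ℕ → Fin n → Set (c ⊔ ℓ₁ ⊔ ℓ₂)
    AlwaysTerminates k v =
      Acc (flip (Step k)) ⁅ v ⁆ ×
      (∀ S → Reaches k v S → ∣ S ∣ ℕ.< k → ∃[ T ] Step k S T)

  record Instance (ε : Carrier) (k : ℕ) : Set (c ⊔ ℓ₁ ⊔ ℓ₂) where
    field
      n     : ℕ
      space : AsymmetricPseudometric n
    open AsymmetricPseudometric space public
    field
      k≤n       : k ℕ.≤ n
      symmetric : IsSymmetricUpTo ε
      R*        : Carrier
      optimum   : IsOptimum k R*
      positive  : 0# < R*

  record State : Set c where
    constructor ⟪_,_,_,_⟫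
    field
      reg  : ℕ → ℕ
      mem  : ℕ → ℕ
      sreg : ℕ → Carrier
      smem : ℕ → Carrier
  open State public

  Holds : State → Test → Set ℓ₂
  Holds σ (i <ᵣ j) = Level.Lift ℓ₂ (reg σ i ℕ.< reg σ j)
  Holds σ (x ≤ₛ y) = sreg σ x ≤ sreg σ y

  module Semantics {n : ℕ} (M : AsymmetricPseudometric n) where
    open AsymmetricPseudometric M using (d)

    infix 3 _⊢_↝_ _⊢_⇓[_]_

    data _⊢_↝_ : State → Instr → State → Set c where
      const  : ∀ {r m s t i a} →
        ⟪ r , m , s , t ⟫ ⊢ const i a ↝ ⟪ r [ i ↦ a ] , m , s , t ⟫
      move   : ∀ {r m s t i j} →
        ⟪ r , m , s , t ⟫ ⊢ move i j ↝ ⟪ r [ i ↦ r j ] , m , s , t ⟫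
      inc    : ∀ {r m s t i} →
        ⟪ r , m , s , t ⟫ ⊢ inc i ↝ ⟪ r [ i ↦ suc (r i) ] , m , s , t ⟫
      load   : ∀ {r m s t i j} →
        ⟪ r , m , s , t ⟫ ⊢ load i j ↝ ⟪ r [ i ↦ m (r j) ] , m , s , t ⟫
      store  : ∀ {r m s t i j} →
        ⟪ r , m , s , t ⟫ ⊢ store i j ↝ ⟪ r , m [ r i ↦ r j ] , s , t ⟫
      moveₛ  : ∀ {r m s t x y} →
        ⟪ r , m , s , t ⟫ ⊢ moveₛ x y ↝ ⟪ r , m , s [ x ↦ s y ] , t ⟫
      loadₛ  : ∀ {r m s t x j} →
        ⟪ r , m , s , t ⟫ ⊢ loadₛ x j ↝ ⟪ r , m , s [ x ↦ t (r j) ] , t ⟫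
      storeₛ : ∀ {r m s t i y} →
        ⟪ r , m , s , t ⟫ ⊢ storeₛ i y ↝ ⟪ r , m , s , t [ r i ↦ s y ] ⟫
      query  : ∀ {r m s t x i j} (p : r i ℕ.< n) (q : r j ℕ.< n) →
        ⟪ r , m , s , t ⟫ ⊢ query x i j ↝
        ⟪ r , m , s [ x ↦ d (fromℕ< p) (fromℕ< q) ] , t ⟫

    -- σ ⊢ p ⇓[ t ] τ : from σ, p halts in τ after t time units; every
    -- instruction and every evaluation of a test takes one unit.
    data _⊢_⇓[_]_ : State → Program → ℕ → State → Set (c ⊔ ℓ₂) where
      instr : ∀ {σ τ a} → σ ⊢ a ↝ τ → σ ⊢ instr a ⇓[ 1 ] τ
      skip  : ∀ {σ} → σ ⊢ skip ⇓[ 1 ] σ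
      seq   : ∀ {σ τ υ p q t t′} →
        σ ⊢ p ⇓[ t ] τ → τ ⊢ q ⇓[ t′ ] υ → σ ⊢ p ⨾ q ⇓[ t ℕ.+ t′ ] υ
      if-true  : ∀ {σ τ b p q t} → Holds σ b →
        σ ⊢ p ⇓[ t ] τ → σ ⊢ if b then p else q ⇓[ suc t ] τ
      if-false : ∀ {σ τ b p q t} → ¬ Holds σ b →
        σ ⊢ q ⇓[ t ] τ → σ ⊢ if b then p else q ⇓[ suc t ] τ
      while-true  : ∀ {σ τ υ b p t t′} → Holds σ b →
        σ ⊢ p ⇓[ t ] τ → τ ⊢ while b loop p ⇓[ t′ ] υ →
        σ ⊢ while b loop p ⇓[ suc (t ℕ.+ t′) ] υ
      while-false : ∀ {σ b p} → ¬ Holds σ b → σ ⊢ while b loop p ⇓[ 1 ] σ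

    -- Inputs: r₀ = n, r₁ = k, r₂ = the initial point; all else is zero.
    initial : ℕ → Fin n → State
    initial k v = ⟪ input , (λ _ → 0) , (λ _ → 0#) , (λ _ → 0#) ⟫
      where
      input : ℕ → ℕ
      input 0 = n
      input 1 = k
      input 2 = toℕ v
      input _ = 0

    -- The output is the set of points stored in mem[0], …, mem[k-1].
    Outputs : ℕ → State → Subset n → Set
    Outputs k σ S =
      (∀ u → u ∈ S → ∃[ i ] i ℕ.< k × mem σ i ≡ toℕ u) ×
      (∀ i → i ℕ.< k → ∃[ u ] u ∈ S × mem σ i ≡ toℕ u)

{-# OPTIONS --safe #-}

-- Let S be the current greedy set, ∣S∣ < k, and r the largest d_min(u , S).  Every
-- point of an optimal set O is within d_min-distance r of some s ∈ S; since
-- ∣S∣ < ∣O∣, two points o ≠ o′ of O share such an s.  Then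
--   2 R* ≤ d(o,o′) + d(o′,o) ≤ (d(o,s) + d(s,o)) + (d(o′,s) + d(s,o′)) ≤ 2 (2 + ε) r,
-- because dmin + dmax ≤ (2 + ε) dmin.  So each new point is at distance at least
-- R* / (2 + ε) from and to the earlier ones.  Maintaining d_min(u , S) for all u makes
-- a round cost O(n).  The bound is attained by a star started at its centre, whose
-- k leaves form the optimal set.

module Submission where

open import Defs
open import Algebra.Bundles using (CommutativeRing)
import Algebra.Construct.NaturalChoice.Max as NaturalMax
import Algebra.Construct.NaturalChoice.Min as NaturalMin
import Algebra.Properties.Ring as RingProperties
open import Data.Fin using (Fin; zero; suc; toℕ; fromℕ<)
import Data.Fin.Properties as Fin
open import Data.Fin.Subset using (Subset; inside; outside; _∈_; _∉_; _∪_; _-_; ⁅_⁆; ⊤; ∣_∣)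
open import Data.Fin.Subset.Properties
open import Data.List.Base using (List; allFin; cartesianProduct; filter)
import Data.List.Extrema as Extrema
open import Data.List.Membership.Propositional as List using ()
open import Data.List.Membership.Propositional.Properties using (∈-allFin; ∈-cartesianProduct⁺; ∈-filter⁺)
import Data.List.Relation.Unary.All as All
open import Data.List.Relation.Unary.All.Properties using (all-filter)
open import Data.Nat as ℕ using (ℕ; zero; suc; z≤n; s≤s)
import Data.Nat.Properties as ℕ
open import Data.Nat.Tactic.RingSolver using (solve-∀)
open import Data.Product using (Σ-syntax; ∃; ∃₂; ∃-syntax; _×_; _,_; proj₁; proj₂; uncurry)
open import Data.Sum using (_⊎_; inj₁; inj₂)
open import Data.Unit.Base using () renaming (⊤ to Unit)
open import Data.Vec.Base using (_∷_; []; here; there)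
open import Function using (_∘_; flip; case_of_)
open import Induction.WellFounded using (Acc; acc)
open import Level using (Level; lift; _⊔_)
open import Relation.Binary.Construct.Closure.ReflexiveTransitive using (Star; _◅_; _◅◅_) renaming (ε to stop)
open import Relation.Binary.PropositionalEquality as ≡ using (_≡_; _≢_)
open import Relation.Binary.Structures using (IsDecTotalOrder)
open import Relation.Nullary using (¬_; yes; no; contradiction)
open import Relation.Nullary.Decidable using (_×-dec_; ¬?)
open import Relation.Unary using (Pred; Decidable)

-- Cardinalities of finite subsets.

∈-of-nonempty : ∀ {n} (p : Subset n) → 1 ℕ.≤ ∣ p ∣ → ∃ (_∈ p)
∈-of-nonempty (inside  ∷ p) _ = zero , here
∈-of-nonempty (outside ∷ p) h with ∈-of-nonempty p h
... | x , x∈p = suc x , there x∈p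

distinct-∈ : ∀ {n} (p : Subset n) → 2 ℕ.≤ ∣ p ∣ → ∃₂ λ x y → x ∈ p × y ∈ p × x ≢ y
distinct-∈ (inside  ∷ p) (s≤s h) with ∈-of-nonempty p h
... | y , y∈p = zero , suc y , here , there y∈p , λ ()
distinct-∈ (outside ∷ p) h with distinct-∈ p h
... | x , y , x∈p , y∈p , x≢y =
  suc x , suc y , there x∈p , there y∈p , x≢y ∘ Fin.suc-injective

∣p∪⁅x⁆∣≡1+∣p∣ : ∀ {n} (p : Subset n) {x} → x ∉ p → ∣ p ∪ ⁅ x ⁆ ∣ ≡ suc ∣ p ∣
∣p∪⁅x⁆∣≡1+∣p∣ (inside  ∷ p) {zero}  x∉p = contradiction here x∉p
∣p∪⁅x⁆∣≡1+∣p∣ (outside ∷ p) {zero}  x∉p = ≡.cong (suc ∘ ∣_∣) (∪-identityʳ p)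
∣p∪⁅x⁆∣≡1+∣p∣ (inside  ∷ p) {suc x} x∉p = ≡.cong suc (∣p∪⁅x⁆∣≡1+∣p∣ p (x∉p ∘ there))
∣p∪⁅x⁆∣≡1+∣p∣ (outside ∷ p) {suc x} x∉p = ∣p∪⁅x⁆∣≡1+∣p∣ p (x∉p ∘ there)

-- Once the first element of `p` is matched with `y`, injectivity keeps the others away from `y`, so
-- `y` can be deleted from `q`. A relation instead of a function lets a point be near several
-- centres without one being selected.
injective-relation⇒∣p∣≤∣q∣ : ∀ {m n ℓ} (_~_ : Fin m → Fin n → Set ℓ) (p : Subset m) (q : Subset n) →
  (∀ {x} → x ∈ p → ∃[ y ] y ∈ q × x ~ y) →
  (∀ {x x′ y} → x ∈ p → x′ ∈ p → x ~ y → x′ ~ y → x ≡ x′) →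
  ∣ p ∣ ℕ.≤ ∣ q ∣
injective-relation⇒∣p∣≤∣q∣ _~_ [] q total injective = z≤n
injective-relation⇒∣p∣≤∣q∣ _~_ (outside ∷ p) q total injective =
  injective-relation⇒∣p∣≤∣q∣ (_~_ ∘ suc) p q (total ∘ there)
    (λ x∈p x′∈p r r′ → Fin.suc-injective (injective (there x∈p) (there x′∈p) r r′))
injective-relation⇒∣p∣≤∣q∣ _~_ (inside ∷ p) q total injective with total here
... | y , y∈q , 0~y = ℕ.≤-trans (s≤s ∣p∣≤∣q-y∣) (x∈p⇒∣p-x∣<∣p∣ y∈q)
  where
  total′ : ∀ {x} → x ∈ p → ∃[ z ] z ∈ q - y × suc x ~ z
  total′ x∈p with total (there x∈p)
  ... | z , z∈q , x~z = z , x∈p∧x≢y⇒x∈p-y z∈q z≢y , x~z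
    where
    z≢y : z ≢ y
    z≢y ≡.refl = case injective here (there x∈p) 0~y x~z of λ ()

  ∣p∣≤∣q-y∣ : ∣ p ∣ ℕ.≤ ∣ q - y ∣
  ∣p∣≤∣q-y∣ = injective-relation⇒∣p∣≤∣q∣ (_~_ ∘ suc) p (q - y) total′
    (λ x∈p x′∈p r r′ → Fin.suc-injective (injective (there x∈p) (there x′∈p) r r′))

-- Arithmetic in ordered fields, and extrema over finite sets.

module OrderedFieldProperties {c ℓ₁ ℓ₂} (F : OrderedField c ℓ₁ ℓ₂) where
  open OrderedField F

  commutativeRing : CommutativeRing c ℓ₁
  commutativeRing = record { isCommutativeRing = isCommutativeRing }

  open CommutativeRing commutativeRing public using
    ( setoid; ring; refl; sym; trans; +-congˡ; +-congʳ; +-assoc; +-comm; *-congˡ; *-congʳ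
    ; *-assoc; *-comm; *-identityˡ; *-identityʳ; +-identityˡ; +-identityʳ; zeroʳ
    ; distribˡ; distribʳ; -‿inverseˡ; -‿inverseʳ )
    renaming (reflexive to ≈-reflexive)
  open RingProperties ring public using (-‿distribʳ-*)
  open IsDecTotalOrder isDecTotalOrder public using (total; antisym; _≤?_; ≤-respʳ-≈; ≤-respˡ-≈)
    renaming (reflexive to ≤-reflexive; refl to ≤-refl; trans to ≤-trans)
  open NaturalMin totalOrder public using (x⊓y≤x; x⊓y≤y; ⊓-glb; ⊓-sel; ⊓-cong; x≤y⇒x⊓y≈x; x≤y⇒y⊓x≈x)
  open NaturalMax totalOrder public using (x≤x⊔y; x≤y⊔x; ⊔-lub)
  open import Relation.Binary.Reasoning.Setoid setoid

  ≰⇒≥ : ∀ {x y} → ¬ (x ≤ y) → y ≤ x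
  ≰⇒≥ {x} {y} x≰y with total x y
  ... | inj₁ x≤y = contradiction x≤y x≰y
  ... | inj₂ y≤x = y≤x

  +-monoʳ-≤ : ∀ {x y} z → x ≤ y → z + x ≤ z + y
  +-monoʳ-≤ {x} {y} z x≤y = ≤-respʳ-≈ (+-comm y z) (≤-respˡ-≈ (+-comm x z) (+-monoˡ-≤ z x≤y))

  +-mono-≤ : ∀ {x y u v} → x ≤ y → u ≤ v → x + u ≤ y + v
  +-mono-≤ {y = y} {u} x≤y u≤v = ≤-trans (+-monoˡ-≤ u x≤y) (+-monoʳ-≤ y u≤v)

  +-cancelʳ-≤ : ∀ {x y} z → x + z ≤ y + z → x ≤ y
  +-cancelʳ-≤ z x+z≤y+z = ≤-respʳ-≈ (cancel _) (≤-respˡ-≈ (cancel _) (+-monoˡ-≤ (- z) x+z≤y+z))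
    where
    cancel : ∀ x → x + z + - z ≈ x
    cancel x = trans (+-assoc x z (- z)) (trans (+-congˡ (-‿inverseʳ z)) (+-identityʳ x))

  -- Halving without division: if `y ≤ x`, then `x + x ≤ y + y ≤ y + x`, and `x` cancels.
  x+x≤y+y⇒x≤y : ∀ {x y} → x + x ≤ y + y → x ≤ y
  x+x≤y+y⇒x≤y {x} {y} h with total x y
  ... | inj₁ x≤y = x≤y
  ... | inj₂ y≤x = +-cancelʳ-≤ x (≤-trans h (+-monoʳ-≤ y y≤x))

  x≤y+x : ∀ {x y} → 0# ≤ y → x ≤ y + x
  x≤y+x {x} 0≤y = ≤-respˡ-≈ (+-identityˡ x) (+-monoˡ-≤ x 0≤y)

  x≤x+y : ∀ {x y} → 0# ≤ y → x ≤ x + y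
  x≤x+y {x} {y} 0≤y = ≤-respʳ-≈ (+-comm y x) (x≤y+x 0≤y)

  +-nonNegative : ∀ {x y} → 0# ≤ x → 0# ≤ y → 0# ≤ x + y
  +-nonNegative 0≤x 0≤y = ≤-trans 0≤y (x≤y+x 0≤x)

  x≤y⇒0≤y-x : ∀ {x y} → x ≤ y → 0# ≤ y + - x
  x≤y⇒0≤y-x {x} x≤y = ≤-respˡ-≈ (-‿inverseʳ x) (+-monoˡ-≤ (- x) x≤y)

  0≤y-x⇒x≤y : ∀ {x y} → 0# ≤ y + - x → x ≤ y
  0≤y-x⇒x≤y {x} 0≤y-x = +-cancelʳ-≤ (- x) (≤-respˡ-≈ (sym (-‿inverseʳ x)) 0≤y-x)

  *-monoʳ-≤ : ∀ {x y z} → 0# ≤ z → x ≤ y → z * x ≤ z * y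
  *-monoʳ-≤ {x} {y} {z} 0≤z x≤y = 0≤y-x⇒x≤y (≤-respʳ-≈ z[y-x]≈zy-zx (*-nonNegative 0≤z (x≤y⇒0≤y-x x≤y)))
    where
    z[y-x]≈zy-zx : z * (y + - x) ≈ z * y + - (z * x)
    z[y-x]≈zy-zx = trans (distribˡ z y (- x)) (+-congˡ (sym (-‿distribʳ-* z x)))

  0≤1 : 0# ≤ 1#
  0≤1 with total 0# 1#
  ... | inj₁ 0≤1 = 0≤1
  ... | inj₂ 1≤0 = ≤-respʳ-≈ -1*-1≈1 (*-nonNegative 0≤-1 0≤-1)
    where
    0≤-1 : 0# ≤ - 1#
    0≤-1 = ≤-respʳ-≈ (+-identityˡ (- 1#)) (x≤y⇒0≤y-x 1≤0)

    -1*-1≈1 : - 1# * - 1# ≈ 1#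
    -1*-1≈1 = +-cancelʳ (- 1#) (- 1# * - 1#) 1# (begin
      - 1# * - 1# + - 1#        ≈⟨ +-congˡ (*-identityʳ (- 1#)) ⟨
      - 1# * - 1# + - 1# * 1#   ≈⟨ distribˡ (- 1#) (- 1#) 1# ⟨
      - 1# * (- 1# + 1#)        ≈⟨ *-congˡ (-‿inverseˡ 1#) ⟩
      - 1# * 0#                 ≈⟨ zeroʳ (- 1#) ⟩
      0#                        ≈⟨ -‿inverseʳ 1# ⟨
      1# + - 1#                 ∎)
      where open RingProperties ring using (+-cancelʳ)

  0<x≤y⇒y≰0 : ∀ {x y} → 0# < x → x ≤ y → ¬ (y ≤ 0#)
  0<x≤y⇒y≰0 (0≤x , 0≉x) x≤y y≤0 = 0≉x (antisym 0≤x (≤-trans x≤y y≤0))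

  0<⇒≉0 : ∀ {x} → 0# < x → ¬ (x ≈ 0#)
  0<⇒≉0 (_ , 0≉x) = 0≉x ∘ sym

  0<⇒0≤⁻¹ : ∀ {x} → 0# < x → 0# ≤ x ⁻¹
  0<⇒0≤⁻¹ {x} 0<x@(0≤x , _) with total 0# (x ⁻¹)
  ... | inj₁ 0≤x⁻¹ = 0≤x⁻¹
  ... | inj₂ x⁻¹≤0 = contradiction (antisym 0≤1 1≤0) 0≉1
    where
    1≤0 : 1# ≤ 0#
    1≤0 = ≤-respˡ-≈ (⁻¹-inverseʳ x (0<⇒≉0 0<x)) (≤-respʳ-≈ (zeroʳ x) (*-monoʳ-≤ 0≤x x⁻¹≤0))

  x≤y*z⇒x/y≤z : ∀ {x y z} → 0# < y → x ≤ y * z → x / y ≤ z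
  x≤y*z⇒x/y≤z {x} {y} {z} 0<y x≤yz =
    ≤-respˡ-≈ (*-comm (y ⁻¹) x) (≤-respʳ-≈ y⁻¹[yz]≈z (*-monoʳ-≤ (0<⇒0≤⁻¹ 0<y) x≤yz))
    where
    y⁻¹[yz]≈z : y ⁻¹ * (y * z) ≈ z
    y⁻¹[yz]≈z = begin
      y ⁻¹ * (y * z)  ≈⟨ *-assoc (y ⁻¹) y z ⟨
      y ⁻¹ * y * z    ≈⟨ *-congʳ (*-comm (y ⁻¹) y) ⟩
      y * y ⁻¹ * z    ≈⟨ *-congʳ (⁻¹-inverseʳ y (0<⇒≉0 0<y)) ⟩
      1# * z          ≈⟨ *-identityˡ z ⟩
      z               ∎

  0<2+ε : ∀ {ε} → 0# ≤ ε → 0# < 2# + ε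
  0<2+ε {ε} 0≤ε = ≤-trans 0≤1 1≤2+ε , λ 0≈2+ε → 0≉1 (antisym 0≤1 (≤-respʳ-≈ (sym 0≈2+ε) 1≤2+ε))
    where
    1≤2+ε : 1# ≤ 2# + ε
    1≤2+ε = ≤-trans (x≤y+x 0≤1) (x≤x+y 0≤ε)

  module _ {a ℓ} {A : Set a} {P : Pred A ℓ} (P? : Decidable P) (xs : List A)
           (complete : ∀ x → P x → x List.∈ xs) (f : A → Carrier) where

    abstract
      ∃-minimiser : ∃ P → ∃[ x ] P x × (∀ y → P y → f x ≤ f y)
      ∃-minimiser (x₀ , px₀) =
        -- The default `x₀` satisfies `P`, as do all the filtered elements, so the result does
        -- whichever of them it is.
        argmin f x₀ ys , argmin-all f px₀ (all-filter P? xs) ,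
        λ y py → All.lookup (f[argmin]≤f[xs] x₀ ys) (∈-filter⁺ P? (complete y py) py)
        where
        open Extrema totalOrder

        ys : List A
        ys = filter P? xs

  abstract
    ∃-maximiser : ∀ {n} (f : Fin n → Carrier) → Fin n → ∃[ x ] (∀ y → f y ≤ f x)
    ∃-maximiser {n} f x₀ = argmax f x₀ (allFin n) ,
      λ y → All.lookup (f[xs]≤f[argmax] x₀ (allFin n)) (∈-allFin y)
      where open Extrema totalOrder

-- Diversities, distances to a set and farthest points.

module SpaceProperties {c ℓ₁ ℓ₂} (F : OrderedField c ℓ₁ ℓ₂) {n} (M : Diversity.AsymmetricPseudometric F n) where
  open OrderedField F
  open OrderedFieldProperties F
  open Diversity F
  open AsymmetricPseudometric M

  ∃-div : ∀ S → 2 ℕ.≤ ∣ S ∣ → ∃ (IsDiv S)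
  ∃-div S 2≤∣S∣ with distinct-∈ S 2≤∣S∣
  ... | x , y , x∈S , y∈S , x≢y
    with ∃-minimiser (λ (u , v) → u ∈? S ×-dec v ∈? S ×-dec ¬? (u Fin.≟ v))
           (cartesianProduct (allFin n) (allFin n))
           (λ (u , v) _ → ∈-cartesianProduct⁺ (∈-allFin u) (∈-allFin v))
           (uncurry d) ((x , y) , x∈S , y∈S , x≢y)
  ... | (u , v) , (u∈S , v∈S , u≢v) , minimal =
    d u v , (u , v , u∈S , v∈S , u≢v , refl) ,
    λ { r (u′ , v′ , u′∈S , v′∈S , u′≢v′ , r≈d) →
        ≤-respʳ-≈ (sym r≈d) (minimal (u′ , v′) (u′∈S , v′∈S , u′≢v′)) }

  ∃-distance : ∀ u {S x} → x ∈ S → ∃ (IsDistance u S)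
  ∃-distance u {S} x∈S
    with ∃-minimiser (_∈? S) (allFin n) (λ s _ → ∈-allFin s) (dmin u) (_ , x∈S)
  ... | s , s∈S , minimal =
    dmin u s , (s , s∈S , refl) ,
    λ { r (s′ , s′∈S , r≈d) → ≤-respʳ-≈ (sym r≈d) (minimal s′ s′∈S) }

  distance-unique : ∀ {u S r r′} → IsDistance u S r → IsDistance u S r′ → r ≈ r′
  distance-unique (p , m) (p′ , m′) = antisym (m _ p′) (m′ _ p)

  distance-resp-≈ : ∀ {u S r r′} → r ≈ r′ → IsDistance u S r → IsDistance u S r′
  distance-resp-≈ r≈r′ ((s , s∈S , r≈d) , minimal) =
    (s , s∈S , trans (sym r≈r′) r≈d) , λ x px → ≤-respˡ-≈ r≈r′ (minimal x px)

  distance-⁅⁆ : ∀ u s → IsDistance u ⁅ s ⁆ (dmin u s)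
  distance-⁅⁆ u s = (s , x∈⁅x⁆ s , refl) , minimal
    where
    minimal : ∀ r → (∃[ s′ ] s′ ∈ ⁅ s ⁆ × r ≈ dmin u s′) → dmin u s ≤ r
    minimal r (s′ , s′∈⁅s⁆ , r≈d) with x∈⁅y⁆⇒x≡y s s′∈⁅s⁆
    ... | ≡.refl = ≤-reflexive (sym r≈d)

  -- This recurrence makes a round linear: a new centre costs one comparison per point, however many
  -- centres there are.
  distance-∪⁅⁆ : ∀ {u S r} s → IsDistance u S r → IsDistance u (S ∪ ⁅ s ⁆) (dmin u s ⊓ r)
  distance-∪⁅⁆ {u} {S} {r} s ((s₀ , s₀∈S , r≈d₀) , minimal) = attained , lower-bound
    where
    attained : ∃[ s′ ] s′ ∈ S ∪ ⁅ s ⁆ × dmin u s ⊓ r ≈ dmin u s′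
    attained with ⊓-sel (dmin u s) r
    ... | inj₁ ≈d = s , q⊆p∪q S ⁅ s ⁆ (x∈⁅x⁆ s) , ≈d
    ... | inj₂ ≈r = s₀ , p⊆p∪q ⁅ s ⁆ s₀∈S , trans ≈r r≈d₀

    lower-bound : ∀ r′ → (∃[ s′ ] s′ ∈ S ∪ ⁅ s ⁆ × r′ ≈ dmin u s′) → dmin u s ⊓ r ≤ r′
    lower-bound r′ (s′ , s′∈ , r′≈d) with x∈p∪q⁻ S ⁅ s ⁆ s′∈
    ... | inj₁ s′∈S = ≤-trans (x⊓y≤y (dmin u s) r) (minimal r′ (s′ , s′∈S , r′≈d))
    ... | inj₂ s′∈⁅s⁆ with x∈⁅y⁆⇒x≡y s s′∈⁅s⁆
    ...   | ≡.refl = ≤-respʳ-≈ (sym r′≈d) (x⊓y≤x (dmin u s) r)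

  -- Turns a table of distances with a maximal entry into an admissible greedy choice. It serves
  -- both the existence of a choice and the correctness of the program, whose scalar memory is such
  -- a table.
  farthest : ∀ {S v} (f : Fin n → Carrier) → (∀ u → IsDistance u S (f u)) →
    (∀ u → f u ≤ f v) → IsFarthest S v
  farthest {v = v} f dist maximal = f v , dist v , (v , dist v) ,
    λ { r (u , r-dist) → ≤-respˡ-≈ (distance-unique (dist u) r-dist) (maximal u) }

  ∃-farthest : ∀ {S x} → x ∈ S → ∃ (IsFarthest S)
  ∃-farthest {x = x} x∈S = proj₁ maximum , farthest distance isDistance (proj₂ maximum)
    where
    distance : Fin n → Carrier
    distance u = proj₁ (∃-distance u x∈S)

    isDistance : ∀ u → IsDistance u _ (distance u)
    isDistance u = proj₂ (∃-distance u x∈S)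

    maximum : ∃[ v ] (∀ u → distance u ≤ distance v)
    maximum = ∃-maximiser distance x

  dmin-reflexive : ∀ u → dmin u u ≈ 0#
  dmin-reflexive u = trans (x≤y⇒x⊓y≈x ≤-refl) (reflexive u)

  d+d≤[2+ε]*dmin : ∀ {ε} → IsSymmetricUpTo ε → ∀ u v → d u v + d v u ≤ (2# + ε) * dmin u v
  d+d≤[2+ε]*dmin {ε} symmetric u v = ≤-respʳ-≈ split sum≤
    where
    m = dmin u v

    split : m + (1# + ε) * m ≈ (2# + ε) * m
    split = trans (+-congʳ (sym (*-identityˡ m)))
      (trans (sym (distribʳ m 1# (1# + ε))) (*-congʳ (sym (+-assoc 1# 1# ε))))

    sum≤ : d u v + d v u ≤ m + (1# + ε) * m
    -- The smaller of the two distances is at most `dmin`; the other is bounded through `dmax` by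
    -- symmetry up to `ε`.
    sum≤ = case total (d u v) (d v u) of λ
      { (inj₁ uv≤vu) → +-mono-≤ (⊓-glb ≤-refl uv≤vu) (≤-trans (x≤y⊔x (d u v) (d v u)) (symmetric u v))
      ; (inj₂ vu≤uv) → ≤-respˡ-≈ (+-comm (d v u) (d u v))
          (+-mono-≤ (⊓-glb vu≤uv ≤-refl) (≤-trans (x≤x⊔y (d u v) (d v u)) (symmetric u v)))
      }

-- The greedy algorithm: termination and approximation guarantee.

module Greedy {c ℓ₁ ℓ₂} (F : OrderedField c ℓ₁ ℓ₂)
  {ε : OrderedField.Carrier F} (0≤ε : OrderedField._≤_ F (OrderedField.0# F) ε)
  {k : ℕ} (2≤k : 2 ℕ.≤ k) (I : Diversity.Instance F ε k) where
  open OrderedField F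
  open OrderedFieldProperties F
  open Diversity F
  open Instance I
  open SpaceProperties F space

  module _ {S : Subset n} (∣S∣<k : ∣ S ∣ ℕ.< k) where

    -- Bounding d(o,o′) or d(o′,o) alone may cost dmax twice; their sum uses each of
    -- the four distances between s and o, o′ once.
    R*≤[2+ε]*farthest : ∀ {r} → IsMaximum (λ x → ∃[ u ] IsDistance u S x) r →
      ∀ {x} → x ∈ S → R* ≤ (2# + ε) * r
    R*≤[2+ε]*farthest {r} (_ , maximal) x∈S with R* ≤? (2# + ε) * r
    ... | yes R*≤ = R*≤
    ... | no  R*≰ with optimum
    ...   | (O , ∣O∣≡k , _ , O-separated) , _ =
      -- If `R*` exceeded the bound, no two points of `O` could be within `r` of the same centre,
      -- and the pigeonhole principle would give `k ≤ ∣ S ∣`.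
      contradiction ∣S∣<k (ℕ.≤⇒≯ (≡.subst (ℕ._≤ ∣ S ∣) ∣O∣≡k
        (injective-relation⇒∣p∣≤∣q∣ (λ o s → dmin o s ≤ r) O S (λ {o} _ → near o) injective)))
      where
      0≤2+ε : 0# ≤ 2# + ε
      0≤2+ε = proj₁ (0<2+ε 0≤ε)

      near : ∀ u → ∃[ s ] s ∈ S × dmin u s ≤ r
      near u with ∃-distance u x∈S
      ... | r′ , dist@((s , s∈S , r′≈d) , _) = s , s∈S , ≤-respˡ-≈ r′≈d (maximal r′ (u , dist))

      detour : ∀ {u s} → dmin u s ≤ r → d u s + d s u ≤ (2# + ε) * r
      detour near = ≤-trans (d+d≤[2+ε]*dmin symmetric _ _) (*-monoʳ-≤ 0≤2+ε near)

      -- Exchanging the second and fourth terms pairs the two directions between `o` and `s`, and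
      -- those between `o′` and `s`, as `detour` requires.
      regroup : ∀ a b c d → (a + b) + (c + d) ≈ (a + d) + (c + b)
      regroup a b c d = begin
        (a + b) + (c + d)  ≈⟨ +-assoc a b (c + d) ⟩
        a + (b + (c + d))  ≈⟨ +-congˡ (+-comm b (c + d)) ⟩
        a + ((c + d) + b)  ≈⟨ +-congˡ (+-congʳ (+-comm c d)) ⟩
        a + ((d + c) + b)  ≈⟨ +-congˡ (+-assoc d c b) ⟩
        a + (d + (c + b))  ≈⟨ +-assoc a d (c + b) ⟨
        (a + d) + (c + b)  ∎
        where open import Relation.Binary.Reasoning.Setoid setoid

      injective : ∀ {o o′ s} → o ∈ O → o′ ∈ O → dmin o s ≤ r → dmin o′ s ≤ r → o ≡ o′
      injective {o} {o′} {s} o∈O o′∈O near near′ with o Fin.≟ o′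
      ... | yes o≡o′ = o≡o′
      ... | no  o≢o′ = contradiction (x+x≤y+y⇒x≤y 2R*≤) R*≰
        where
        2R*≤ : R* + R* ≤ (2# + ε) * r + (2# + ε) * r
        2R*≤ = ≤-trans
          (+-mono-≤ (O-separated _ (o , o′ , o∈O , o′∈O , o≢o′ , refl))
                    (O-separated _ (o′ , o , o′∈O , o∈O , o≢o′ ∘ ≡.sym , refl)))
          (≤-trans (+-mono-≤ (triangle o o′ s) (triangle o′ o s))
          (≤-respˡ-≈ (sym (regroup (d o s) (d s o′) (d o′ s) (d s o)))
          (+-mono-≤ (detour near) (detour near′))))

    farthest⇒separated : ∀ {v} → IsFarthest S v → ∀ {s} → s ∈ S → R* ≤ (2# + ε) * dmin v s
    farthest⇒separated (r , (_ , minimal) , isMax) s∈S =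
      ≤-trans (R*≤[2+ε]*farthest isMax s∈S)
        (*-monoʳ-≤ (proj₁ (0<2+ε 0≤ε)) (minimal _ (_ , s∈S , refl)))

    -- A member of `S` has `dmin` equal to zero to itself, which separation by a positive `R*`
    -- excludes. Hence every step enlarges the set although the maximum ranges over the whole space.
    farthest⇒∉ : ∀ {v} → IsFarthest S v → v ∉ S
    farthest⇒∉ {v} far v∈S = 0<x≤y⇒y≰0 positive (farthest⇒separated far v∈S)
      (≤-reflexive (trans (*-congˡ (dmin-reflexive v)) (zeroʳ (2# + ε))))

  -- `v∈S` keeps the set nonempty, so that distances to it exist, and later keeps the centre of the
  -- star selected. `separated` is in multiplied form; the only division comes at the end of
  -- `approximation`.
  record Invariant (v : Fin n) (S : Subset n) : Set ℓ₂ where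
    field
      v∈S       : v ∈ S
      ∣S∣≤k     : ∣ S ∣ ℕ.≤ k
      separated : ∀ {u w} → u ∈ S → w ∈ S → u ≢ w → R* ≤ (2# + ε) * d u w

  initially : ∀ v → Invariant v ⁅ v ⁆
  initially v = record
    { v∈S       = x∈⁅x⁆ v
    ; ∣S∣≤k     = ℕ.≤-trans (ℕ.≤-reflexive (∣⁅x⁆∣≡1 v)) (ℕ.<⇒≤ 2≤k)
    ; separated = λ u∈ w∈ u≢w → contradiction
        (≡.trans (x∈⁅y⁆⇒x≡y v u∈) (≡.sym (x∈⁅y⁆⇒x≡y v w∈))) u≢w
    }

  ∣step∣ : ∀ {S T} → Step k S T → ∣ T ∣ ≡ suc ∣ S ∣
  ∣step∣ {S} (∣S∣<k , _ , far , ≡.refl) = ∣p∪⁅x⁆∣≡1+∣p∣ S (farthest⇒∉ ∣S∣<k far)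

  step-invariant : ∀ {v S T} → Step k S T → Invariant v S → Invariant v T
  step-invariant {S = S} step@(∣S∣<k , x , far , ≡.refl) inv = record
    { v∈S       = p⊆p∪q ⁅ x ⁆ v∈S
    ; ∣S∣≤k     = ≡.subst (ℕ._≤ k) (≡.sym (∣step∣ step)) ∣S∣<k
    ; separated = λ u∈ w∈ u≢w → separated′ (x∈p∪q⁻ S ⁅ x ⁆ u∈) (x∈p∪q⁻ S ⁅ x ⁆ w∈) u≢w
    }
    where
    open Invariant inv
    0≤2+ε = proj₁ (0<2+ε 0≤ε)

    separated′ : ∀ {u w} → u ∈ S ⊎ u ∈ ⁅ x ⁆ → w ∈ S ⊎ w ∈ ⁅ x ⁆ → u ≢ w → R* ≤ (2# + ε) * d u w
    -- The new point may be the source or the target of the distance; `dmin` bounds both directions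
    -- from below.
    separated′ (inj₁ u∈S) (inj₁ w∈S) u≢w = separated u∈S w∈S u≢w
    separated′ {u} (inj₁ u∈S) (inj₂ w∈⁅x⁆) u≢w with x∈⁅y⁆⇒x≡y x w∈⁅x⁆
    ... | ≡.refl = ≤-trans (farthest⇒separated ∣S∣<k far u∈S) (*-monoʳ-≤ 0≤2+ε (x⊓y≤y (d x u) (d u x)))
    separated′ {w = w} (inj₂ u∈⁅x⁆) (inj₁ w∈S) u≢w with x∈⁅y⁆⇒x≡y x u∈⁅x⁆
    ... | ≡.refl = ≤-trans (farthest⇒separated ∣S∣<k far w∈S) (*-monoʳ-≤ 0≤2+ε (x⊓y≤x (d x w) (d w x)))
    separated′ (inj₂ u∈⁅x⁆) (inj₂ w∈⁅x⁆) u≢w =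
      contradiction (≡.trans (x∈⁅y⁆⇒x≡y x u∈⁅x⁆) (≡.sym (x∈⁅y⁆⇒x≡y x w∈⁅x⁆))) u≢w

  star-invariant : ∀ {v S T} → Star (Step k) S T → Invariant v S → Invariant v T
  star-invariant stop           inv = inv
  star-invariant (step ◅ steps) inv = star-invariant steps (step-invariant step inv)

  reaches-invariant : ∀ {v S} → Reaches k v S → Invariant v S
  reaches-invariant {v} reaches = star-invariant reaches (initially v)

  progress : ∀ {v S} → Reaches k v S → ∣ S ∣ ℕ.< k → ∃ (Step k S)
  progress reaches ∣S∣<k with ∃-farthest (Invariant.v∈S (reaches-invariant reaches))
  ... | x , far = _ , ∣S∣<k , x , far , ≡.refl

  -- `m` bounds the number of points still to be added; each step uses up one because it increases
  -- the cardinality by exactly one.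
  accessible : ∀ m S → k ℕ.≤ m ℕ.+ ∣ S ∣ → Acc (flip (Step k)) S
  accessible zero    S k≤m+∣S∣ = acc λ (∣S∣<k , _) → contradiction ∣S∣<k (ℕ.≤⇒≯ k≤m+∣S∣)
  accessible (suc m) S k≤m+∣S∣ = acc λ {T} step → accessible m T
    (≡.subst (λ t → k ℕ.≤ m ℕ.+ t) (≡.sym (∣step∣ step))
      (≡.subst (k ℕ.≤_) (≡.sym (ℕ.+-suc m ∣ S ∣)) k≤m+∣S∣))

  alwaysTerminates : ∀ v → AlwaysTerminates k v
  alwaysTerminates v = accessible k ⁅ v ⁆ (ℕ.m≤m+n k _) , λ S → progress

  -- Ensures that a claim about all returned sets is not vacuous. The recursion is on accessibility,
  -- and `progress` supplies each next step.
  ∃-returns : ∀ v → ∃ (Returns k v)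
  ∃-returns v = run (proj₁ (alwaysTerminates v)) stop
    where
    run : ∀ {S} → Acc (flip (Step k)) S → Reaches k v S → ∃ (Returns k v)
    run {S} (acc rec) reaches with ∣ S ∣ ℕ.<? k
    ... | no  ∣S∣≮k = S , reaches , ∣S∣≮k
    ... | yes ∣S∣<k with progress reaches ∣S∣<k
    ...   | T , step = run (rec step) (reaches ◅◅ (step ◅ stop))

  returns⇒∣S∣≡k : ∀ {v S} → Returns k v S → ∣ S ∣ ≡ k
  returns⇒∣S∣≡k (reaches , ∣S∣≮k) =
    ℕ.≤-antisym (Invariant.∣S∣≤k (reaches-invariant reaches)) (ℕ.≮⇒≥ ∣S∣≮k)

  returns⇒∃-div : ∀ {v S} → Returns k v S → ∃ (IsDiv S)
  returns⇒∃-div {S = S} returns = ∃-div S (≡.subst (2 ℕ.≤_) (≡.sym (returns⇒∣S∣≡k returns)) 2≤k)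

  approximation : ∀ {v S} → Returns k v S → ∃[ D ] IsDiv S D × R* / (2# + ε) ≤ D
  approximation returns@(reaches , _) with returns⇒∃-div returns
  ... | D , isDiv@((u , w , u∈S , w∈S , u≢w , D≈d) , _) =
    D , isDiv , ≤-respʳ-≈ (sym D≈d)
      (x≤y*z⇒x/y≤z (0<2+ε 0≤ε) (Invariant.separated (reaches-invariant reaches) u∈S w∈S u≢w))

-- The program and its time bound.

[↦]-same : ∀ {a} {A : Set a} (f : ℕ → A) i x → (f [ i ↦ x ]) i ≡ x
[↦]-same f i x with i ℕ.≟ i
... | yes _   = ≡.refl
... | no  i≢i = contradiction ≡.refl i≢i

[↦]-other : ∀ {a} {A : Set a} (f : ℕ → A) {i j} x → i ≢ j → (f [ i ↦ x ]) j ≡ f j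
[↦]-other f {i} {j} x i≢j with i ℕ.≟ j
... | yes i≡j = contradiction i≡j i≢j
... | no  _   = ≡.refl

-- r₀ = n, r₁ = k, r₂ = the last chosen point, r₃ = ∣S∣, r₄ = a loop counter,
-- mem[i] = the i-th chosen point, smem[u] = d_min(u , S).

minimum₀₁ : Program
minimum₀₁ = if 0 ≤ₛ 1 then skip else instr (moveₛ 0 1)

evalDistance : Program
evalDistance = instr (query 0 4 2) ⨾ instr (query 1 2 4) ⨾ minimum₀₁

updateDistance : Program
updateDistance = evalDistance ⨾ instr (loadₛ 1 4) ⨾ minimum₀₁

forEachPoint : Program → Program
forEachPoint p = instr (const 4 0) ⨾ while 4 <ᵣ 0 loop (p ⨾ instr (storeₛ 4 0) ⨾ instr (inc 4))

updateMaximum : Program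
updateMaximum = instr (loadₛ 0 4) ⨾ if 2 ≤ₛ 0 then (instr (moveₛ 2 0) ⨾ instr (move 2 4)) else skip

-- Point 0 is the first candidate, so `loadₛ 2 2` reads the entry of that point. Register 2 may be
-- overwritten since the previously chosen point has already been accounted for in every stored
-- distance.
findFarthest : Program
findFarthest = instr (const 2 0) ⨾ instr (const 4 0) ⨾ instr (loadₛ 2 2) ⨾
  while 4 <ᵣ 0 loop (updateMaximum ⨾ instr (inc 4))

addPoint : Program
addPoint = instr (store 3 2) ⨾ instr (inc 3)

-- The first pass uses `evalDistance`, not `updateDistance`: scalar memory starts at zero, and a
-- minimum with zero would never leave it.
greedy : Program
greedy = addPoint ⨾ forEachPoint evalDistance ⨾
  while 3 <ᵣ 1 loop (findFarthest ⨾ addPoint ⨾ forEachPoint updateDistance)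

-- Each round costs at most 25 n, as does the part outside of the k ∸ 1 rounds.
running-time : ∀ {k n} → 2 ℕ.≤ k → 1 ℕ.≤ n →
  2 ℕ.+ ((2 ℕ.+ n ℕ.* 7) ℕ.+ suc ((k ℕ.∸ 1) ℕ.* suc ((4 ℕ.+ n ℕ.* 6) ℕ.+ (2 ℕ.+ (2 ℕ.+ n ℕ.* 10)))))
    ℕ.≤ 25 ℕ.* (k ℕ.* n)
running-time {suc k} {suc n} (s≤s _) (s≤s _) = ℕ.m+n≤o⇒m≤o _ (ℕ.≤-reflexive (lemma k n))
  where
  -- The summand starting with 13 is the exact slack after shifting `k` and `n` by one, which turns
  -- the bound into a polynomial identity.
  lemma : ∀ k n →
    2 ℕ.+ ((2 ℕ.+ suc n ℕ.* 7) ℕ.+ suc (k ℕ.* suc ((4 ℕ.+ suc n ℕ.* 6) ℕ.+ (2 ℕ.+ (2 ℕ.+ suc n ℕ.* 10)))))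
      ℕ.+ (13 ℕ.+ n ℕ.* 18 ℕ.+ k ℕ.* n ℕ.* 9)
      ≡ 25 ℕ.* (suc k ℕ.* suc n)
  lemma = solve-∀

-- Total-correctness rules with time bounds.

module ProgramLogic {c ℓ₁ ℓ₂} (F : OrderedField c ℓ₁ ℓ₂) {n} (M : Diversity.AsymmetricPseudometric F n) where
  open OrderedField F using (Carrier; _≤_)
  open OrderedFieldProperties F using (_≤?_)
  open Diversity F
  open AsymmetricPseudometric M using (d)
  open Semantics M public

  -- A Hoare triple for one start state. It carries an upper bound instead of the exact time because
  -- the branches of a conditional can differ in cost.
  record Exec {q} (σ : State) (p : Program) (bound : ℕ) (Q : State → Set q) : Set (c ⊔ ℓ₂ ⊔ q) where
    constructor exec
    field
      {time}  : ℕ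
      {final} : State
      run     : σ ⊢ p ⇓[ time ] final
      bounded : time ℕ.≤ bound
      post    : Q final

  private variable
    q : Level
    Q Q′ : State → Set q

  exec-instr : ∀ {σ τ a} → σ ⊢ a ↝ τ → Q τ → Exec σ (instr a) 1 Q
  exec-instr step Qτ = exec (instr step) ℕ.≤-refl Qτ

  exec-skip : ∀ {σ} → Q σ → Exec σ skip 1 Q
  exec-skip Qσ = exec skip ℕ.≤-refl Qσ

  exec-map : ∀ {σ p b} → (∀ {τ} → Q τ → Q′ τ) → Exec σ p b Q → Exec σ p b Q′
  exec-map f (exec run bound Qτ) = exec run bound (f Qτ)

  exec-weaken : ∀ {σ p b b′} → b ℕ.≤ b′ → Exec σ p b Q → Exec σ p b′ Q
  exec-weaken b≤b′ (exec run bound Qτ) = exec run (ℕ.≤-trans bound b≤b′) Qτ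

  infixr 5 _exec-⨾_

  _exec-⨾_ : ∀ {σ p p′ b b′} → Exec σ p b Q → (∀ {τ} → Q τ → Exec τ p′ b′ Q′) →
    Exec σ (p ⨾ p′) (b ℕ.+ b′) Q′
  exec run≤ bound≤ Qτ exec-⨾ next with next Qτ
  ... | exec run′ bound′ Q′υ = exec (seq run≤ run′) (ℕ.+-mono-≤ bound≤ bound′) Q′υ

  infixr 5 _↝-⨾_

  _↝-⨾_ : ∀ {σ τ a p b} → σ ⊢ a ↝ τ → Exec τ p b Q → Exec σ (instr a ⨾ p) (suc b) Q
  step ↝-⨾ exec run bound Qτ = exec (seq (instr step) run) (s≤s bound) Qτ

  exec-if-≤ₛ : ∀ {σ x y p p′ b} →
    (sreg σ x ≤ sreg σ y → Exec σ p b Q) → (¬ (sreg σ x ≤ sreg σ y) → Exec σ p′ b Q) →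
    Exec σ (if x ≤ₛ y then p else p′) (suc b) Q
  exec-if-≤ₛ {σ = σ} {x} {y} on-yes on-no with sreg σ x ≤? sreg σ y
  ... | yes x≤y = let exec run bound Qτ = on-yes x≤y in exec (if-true x≤y run) (s≤s bound) Qτ
  ... | no  x≰y = let exec run bound Qτ = on-no x≰y in exec (if-false x≰y run) (s≤s bound) Qτ

  -- Hides the range proofs and the `fromℕ<` of the `query` rule: it suffices to know which points
  -- the registers encode.
  exec-query : ∀ {r m s t x i j} u w → r i ≡ toℕ u → r j ≡ toℕ w →
    ⟪ r , m , s , t ⟫ ⊢ query x i j ↝ ⟪ r , m , s [ x ↦ d u w ] , t ⟫
  exec-query {r} {m} {s} {t} {x} {i} {j} u w rᵢ≡u rⱼ≡w =
    ≡.subst₂ (λ u w → ⟪ r , m , s , t ⟫ ⊢ query x i j ↝ ⟪ r , m , s [ x ↦ d u w ] , t ⟫)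
      (point rᵢ≡u) (point rⱼ≡w) (query (in-range rᵢ≡u) (in-range rⱼ≡w))
    where
    in-range : ∀ {a} {u : Fin n} → a ≡ toℕ u → a ℕ.< n
    in-range {u = u} a≡u = ≡.subst (ℕ._< n) (≡.sym a≡u) (Fin.toℕ<n u)

    point : ∀ {a} {u : Fin n} (a≡u : a ≡ toℕ u) → fromℕ< (in-range a≡u) ≡ u
    point a≡u = Fin.toℕ-injective (≡.trans (Fin.toℕ-fromℕ< _) a≡u)

  module _ {i j N b p} (Inv : ℕ → State → Set q)
    (counter : ∀ {m σ} → Inv m σ → reg σ i ≡ m × reg σ j ≡ N)
    (body : ∀ {m σ} → m ℕ.< N → Inv m σ → Exec σ p b (Inv (suc m))) where

    -- `rest` counts the iterations to come. Each pays for its body and one successful test; the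
    -- outer `suc` pays for the failing test that ends the loop.
    exec-for : ∀ rest {m σ} → rest ℕ.+ m ≡ N → Inv m σ →
      Exec σ (while i <ᵣ j loop p) (suc (rest ℕ.* suc b)) (Inv N)
    exec-for zero ≡.refl inv with counter inv
    ... | rᵢ≡m , rⱼ≡N =
      exec (while-false λ (lift rᵢ<rⱼ) → ℕ.<-irrefl (≡.trans rᵢ≡m (≡.sym rⱼ≡N)) rᵢ<rⱼ) (s≤s z≤n) inv
    exec-for (suc rest) {m} rest+m≡N inv with counter inv
    ... | rᵢ≡m , rⱼ≡N
      with m<N ← ≡.subst (m ℕ.<_) rest+m≡N (s≤s (ℕ.m≤n+m m rest))
      with body m<N inv
    ...   | exec run bound inv′ with exec-for rest (≡.trans (ℕ.+-suc rest m) rest+m≡N) inv′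
    ...     | exec run′ bound′ invN =
      exec (while-true (lift (≡.subst₂ ℕ._<_ (≡.sym rᵢ≡m) (≡.sym rⱼ≡N) m<N)) run run′)
        (s≤s (ℕ.≤-trans (ℕ.+-mono-≤ bound bound′) (ℕ.≤-reflexive (ℕ.+-suc b (rest ℕ.* suc b))))) invN

-- Correctness of the program.

module Implementation {c ℓ₁ ℓ₂} (F : OrderedField c ℓ₁ ℓ₂)
  {ε : OrderedField.Carrier F} (0≤ε : OrderedField._≤_ F (OrderedField.0# F) ε)
  {k : ℕ} (2≤k : 2 ℕ.≤ k) (I : Diversity.Instance F ε k) where
  open OrderedField F
  open OrderedFieldProperties F
  open Diversity F
  open Instance I
  open SpaceProperties F space
  open Greedy F 0≤ε 2≤k I
  open ProgramLogic F space

  record Registers (x j m : ℕ) (σ : State) : Set where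
    constructor registers
    field
      r₀ : reg σ 0 ≡ n
      r₁ : reg σ 1 ≡ k
      r₂ : reg σ 2 ≡ x
      r₃ : reg σ 3 ≡ j
      r₄ : reg σ 4 ≡ m

  -- The two branches leave different scalar registers, so these are existentially quantified and
  -- only entry 0 is specified; the equation for the final state records that all else is unchanged.
  exec-minimum : ∀ {r m s t} →
    Exec ⟪ r , m , s , t ⟫ minimum₀₁ 2 (λ τ → ∃[ s′ ] τ ≡ ⟪ r , m , s′ , t ⟫ × s′ 0 ≈ s 0 ⊓ s 1)
  exec-minimum {s = s} = exec-if-≤ₛ
    (λ s₀≤s₁ → exec-skip (s , ≡.refl , sym (x≤y⇒x⊓y≈x s₀≤s₁)))
    (λ s₀≰s₁ → exec-instr moveₛ (_ , ≡.refl , sym (x≤y⇒y⊓x≈x (≰⇒≥ s₀≰s₁))))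

  exec-evalDistance : ∀ {r m s t} u x → r 4 ≡ toℕ u → r 2 ≡ toℕ x →
    Exec ⟪ r , m , s , t ⟫ evalDistance 4 (λ τ → ∃[ s′ ] τ ≡ ⟪ r , m , s′ , t ⟫ × s′ 0 ≈ dmin u x)
  exec-evalDistance u x r₄≡u r₂≡x =
    exec-query u x r₄≡u r₂≡x ↝-⨾ exec-query x u r₂≡x r₄≡u ↝-⨾ exec-minimum

  exec-updateDistance : ∀ {r m s t} u x → r 4 ≡ toℕ u → r 2 ≡ toℕ x →
    Exec ⟪ r , m , s , t ⟫ updateDistance 7
      (λ τ → ∃[ s′ ] τ ≡ ⟪ r , m , s′ , t ⟫ × s′ 0 ≈ dmin u x ⊓ t (toℕ u))
  exec-updateDistance {t = t} u x r₄≡u r₂≡x =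
    exec-evalDistance u x r₄≡u r₂≡x exec-⨾ λ { (s , ≡.refl , s₀≈) →
    loadₛ ↝-⨾ exec-map
      (λ { (s′ , ≡.refl , s′₀≈) →
           s′ , ≡.refl , trans s′₀≈ (⊓-cong s₀≈ (≈-reflexive (≡.cong t r₄≡u))) })
      exec-minimum }

  exec-addPoint : ∀ {x j m σ} → Registers x j m σ → Exec σ addPoint 2
    (λ τ → Registers x (suc j) m τ × mem τ ≡ mem σ [ j ↦ x ] × smem τ ≡ smem σ)
  exec-addPoint {σ = σ} (registers r₀ r₁ r₂ r₃ r₄) =
    store ↝-⨾ exec-instr inc
      (registers r₀ r₁ r₂ (≡.cong suc r₃) r₄ , ≡.cong₂ (mem σ [_↦_]) r₃ r₂ , ≡.refl)

  module _ {ℓ p b} {x : Fin n} {Pre Post : Fin n → Carrier → Set ℓ}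
    (compute : ∀ {r m s t} u → r 4 ≡ toℕ u → r 2 ≡ toℕ x → Pre u (t (toℕ u)) →
      Exec ⟪ r , m , s , t ⟫ p b (λ τ → ∃[ s′ ] τ ≡ ⟪ r , m , s′ , t ⟫ × Post u (s′ 0))) where

    -- An iteration writes only the cell of its own point, so at counter `m` the cells below `m`
    -- satisfy `Post` and the others still satisfy `Pre`. The 2 after `b` is the store and the
    -- increment.
    exec-forEachPoint : ∀ {j m₀ σ} → Registers (toℕ x) j m₀ σ → (∀ u → Pre u (smem σ (toℕ u))) →
      Exec σ (forEachPoint p) (2 ℕ.+ n ℕ.* suc (b ℕ.+ 2))
        (λ τ → Registers (toℕ x) j n τ × mem τ ≡ mem σ × (∀ u → Post u (smem τ (toℕ u))))
    exec-forEachPoint {j} {σ = σ} (registers r₀ r₁ r₂ r₃ _) pre =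
      const ↝-⨾ exec-map
        (λ (regs , mem≡ , done , _) → regs , mem≡ , λ u → done u (Fin.toℕ<n u))
        (exec-for Inv (λ (regs , _) → Registers.r₄ regs , Registers.r₀ regs) body n (ℕ.+-identityʳ n)
          (registers r₀ r₁ r₂ r₃ ≡.refl , ≡.refl , (λ _ ()) , λ u _ → pre u))
      where
      Inv : ℕ → State → Set ℓ
      Inv m τ = Registers (toℕ x) j m τ × mem τ ≡ mem σ ×
        (∀ (u : Fin n) → toℕ u ℕ.< m → Post u (smem τ (toℕ u))) ×
        (∀ u → m ℕ.≤ toℕ u → Pre u (smem τ (toℕ u)))

      body : ∀ {m τ} → m ℕ.< n → Inv m τ →
        Exec τ (p ⨾ instr (storeₛ 4 0) ⨾ instr (inc 4)) (b ℕ.+ 2) (Inv (suc m))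
      body {m} {τ} m<n (registers r₀ r₁ r₂ r₃ r₄ , mem≡ , done , todo) =
        compute u r₄≡u r₂ (todo u (ℕ.≤-reflexive m≡u)) exec-⨾ λ { (s′ , ≡.refl , post) →
        storeₛ ↝-⨾ exec-instr inc
          ( registers r₀ r₁ r₂ r₃ (≡.cong suc r₄) , mem≡
          , (λ w w<1+m → case w Fin.≟ u of λ
              { (yes ≡.refl) → ≡.subst (Post u) (≡.sym (stored s′)) post
              ; (no w≢u)     → ≡.subst (Post w) (≡.sym (kept s′ w≢u))
                  (done w (ℕ.≤∧≢⇒< (ℕ.≤-pred w<1+m) (w≢u ∘ ≡m⇒≡u))) })
          , λ w m<w → ≡.subst (Pre w) (≡.sym (kept s′ λ { ≡.refl → ℕ.<-irrefl m≡u m<w }))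
              (todo w (ℕ.<⇒≤ m<w)) ) }
        where
        u : Fin n
        u = fromℕ< m<n

        m≡u : m ≡ toℕ u
        m≡u = ≡.sym (Fin.toℕ-fromℕ< m<n)

        r₄≡u : reg τ 4 ≡ toℕ u
        r₄≡u = ≡.trans r₄ m≡u

        ≡m⇒≡u : ∀ {w} → toℕ w ≡ m → w ≡ u
        ≡m⇒≡u w≡m = Fin.toℕ-injective (≡.trans w≡m m≡u)

        stored : ∀ s′ → (smem τ [ reg τ 4 ↦ s′ 0 ]) (toℕ u) ≡ s′ 0
        stored s′ = ≡.subst (λ i → (smem τ [ i ↦ s′ 0 ]) (toℕ u) ≡ s′ 0) (≡.sym r₄≡u)
          ([↦]-same (smem τ) (toℕ u) (s′ 0))

        kept : ∀ s′ {w} → w ≢ u → (smem τ [ reg τ 4 ↦ s′ 0 ]) (toℕ w) ≡ smem τ (toℕ w)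
        kept s′ w≢u = [↦]-other (smem τ) (s′ 0)
          (λ r₄≡w → w≢u (Fin.toℕ-injective (≡.trans (≡.sym r₄≡w) r₄≡u)))

  -- The argument in `Fin n` provides `0 < n`, so that point 0 can be the first candidate.
  exec-findFarthest : ∀ {x j m₀ σ} → Fin n → Registers x j m₀ σ →
    Exec σ findFarthest (4 ℕ.+ n ℕ.* 6)
      (λ τ → Σ[ y ∈ Fin n ] Registers (toℕ y) j n τ × mem τ ≡ mem σ × smem τ ≡ smem σ ×
        (∀ (u : Fin n) → smem σ (toℕ u) ≤ smem σ (toℕ y)))
  exec-findFarthest {j = j} {σ = σ} v (registers r₀ r₁ r₂ r₃ r₄) =
    const ↝-⨾ const ↝-⨾ loadₛ ↝-⨾ exec-map
      (λ (y , regs , mem≡ , smem≡ , _ , maximal) →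
        y , regs , mem≡ , smem≡ , λ u → maximal u (Fin.toℕ<n u))
      (exec-for Inv (λ (_ , regs , _) → Registers.r₄ regs , Registers.r₀ regs) body n (ℕ.+-identityʳ n)
        (first , registers r₀ r₁ (≡.sym toℕ-first) r₃ ≡.refl , ≡.refl , ≡.refl
        , ≡.cong (smem σ) (≡.sym toℕ-first) , λ _ ()))
    where
    0<n : 0 ℕ.< n
    0<n = ℕ.≤-<-trans z≤n (Fin.toℕ<n v)

    first : Fin n
    first = fromℕ< 0<n

    toℕ-first : toℕ first ≡ 0
    toℕ-first = Fin.toℕ-fromℕ< 0<n

    -- The candidate `y` need not lie below `m`: at the start `m` is 0 and `y` is already the first
    -- point.
    Inv : ℕ → State → Set (c ⊔ ℓ₂)
    Inv m τ = Σ[ y ∈ Fin n ] Registers (toℕ y) j m τ × mem τ ≡ mem σ × smem τ ≡ smem σ ×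
      sreg τ 2 ≡ smem σ (toℕ y) × (∀ (u : Fin n) → toℕ u ℕ.< m → smem σ (toℕ u) ≤ smem σ (toℕ y))

    body : ∀ {m τ} → m ℕ.< n → Inv m τ → Exec τ (updateMaximum ⨾ instr (inc 4)) 5 (Inv (suc m))
    body {m} {τ} m<n (y , registers r₀ r₁ r₂ r₃ r₄ , mem≡ , ≡.refl , s₂≡ , maximal) =
      (loadₛ ↝-⨾ exec-if-≤ₛ {Q = Updated}
        (λ s₂≤ → moveₛ ↝-⨾ exec-instr move
          (u , registers r₀ r₁ r₄≡u r₃ r₄ , mem≡ , ≡.refl , s₀≡
          , extend (λ w w<m → ≤-trans (maximal w w<m) (≡.subst₂ _≤_ s₂≡ s₀≡ s₂≤)) ≤-refl))
        -- The idle branch takes one unit; its bound is raised to the two units of the updating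
        -- branch.
        (λ s₂≰ → exec-weaken (s≤s z≤n) (exec-skip
          (y , registers r₀ r₁ r₂ r₃ r₄ , mem≡ , ≡.refl , s₂≡
          , extend maximal (≡.subst₂ _≤_ s₀≡ s₂≡ (≰⇒≥ s₂≰))))))
      exec-⨾ λ (y′ , registers r₀ r₁ r₂ r₃ r₄ , mem≡ , smem≡ , s₂≡ , maximal) →
        exec-instr inc (y′ , registers r₀ r₁ r₂ r₃ (≡.cong suc r₄) , mem≡ , smem≡ , s₂≡ , maximal)
      where
      Updated : State → Set (c ⊔ ℓ₂)
      Updated υ = Σ[ y ∈ Fin n ] Registers (toℕ y) j m υ × mem υ ≡ mem σ × smem υ ≡ smem σ ×
        sreg υ 2 ≡ smem σ (toℕ y) × (∀ (u : Fin n) → toℕ u ℕ.< suc m → smem σ (toℕ u) ≤ smem σ (toℕ y))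

      u : Fin n
      u = fromℕ< m<n

      r₄≡u : reg τ 4 ≡ toℕ u
      r₄≡u = ≡.trans r₄ (≡.sym (Fin.toℕ-fromℕ< m<n))

      s₀≡ : smem σ (reg τ 4) ≡ smem σ (toℕ u)
      s₀≡ = ≡.cong (smem σ) r₄≡u

      extend : ∀ {z} → (∀ (w : Fin n) → toℕ w ℕ.< m → smem σ (toℕ w) ≤ z) → smem σ (toℕ u) ≤ z →
        ∀ (w : Fin n) → toℕ w ℕ.< suc m → smem σ (toℕ w) ≤ z
      extend {z} below at w (s≤s w≤m) with toℕ w ℕ.≟ m
      ... | yes w≡m = ≡.subst (λ i → smem σ i ≤ z)
              (≡.trans (Fin.toℕ-fromℕ< m<n) (≡.sym w≡m)) at
      ... | no  w≢m = below w (ℕ.≤∧≢⇒< w≤m w≢m)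

  outputs-⁅⁆ : ∀ {v σ} → mem σ 0 ≡ toℕ v → Outputs 1 σ ⁅ v ⁆
  outputs-⁅⁆ {v} mem≡ =
    (λ u u∈ → 0 , s≤s z≤n , ≡.trans mem≡ (≡.cong toℕ (≡.sym (x∈⁅y⁆⇒x≡y v u∈)))) ,
    λ { 0 _ → v , x∈⁅x⁆ v , mem≡ ; (suc _) (s≤s ()) }

  outputs-∪⁅⁆ : ∀ {j σ τ S x} → mem τ ≡ mem σ [ j ↦ toℕ x ] →
    Outputs j σ S → Outputs (suc j) τ (S ∪ ⁅ x ⁆)
  outputs-∪⁅⁆ {j} {σ} {τ} {S} {x} mem≡ (stored , valid) = stored′ , valid′
    where
    newest : mem τ j ≡ toℕ x
    newest = ≡.trans (≡.cong-app mem≡ j) ([↦]-same (mem σ) j (toℕ x))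

    older : ∀ {i} → i ℕ.< j → mem τ i ≡ mem σ i
    older i<j = ≡.trans (≡.cong-app mem≡ _) ([↦]-other (mem σ) (toℕ x) (ℕ.<⇒≢ i<j ∘ ≡.sym))

    stored′ : ∀ u → u ∈ S ∪ ⁅ x ⁆ → ∃[ i ] i ℕ.< suc j × mem τ i ≡ toℕ u
    stored′ u u∈ with x∈p∪q⁻ S ⁅ x ⁆ u∈
    ... | inj₁ u∈S = let i , i<j , mem≡u = stored u u∈S in
                     i , ℕ.m<n⇒m<1+n i<j , ≡.trans (older i<j) mem≡u
    ... | inj₂ u∈⁅x⁆ = j , ℕ.n<1+n j , ≡.trans newest (≡.cong toℕ (≡.sym (x∈⁅y⁆⇒x≡y x u∈⁅x⁆)))

    valid′ : ∀ i → i ℕ.< suc j → ∃[ u ] u ∈ S ∪ ⁅ x ⁆ × mem τ i ≡ toℕ u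
    valid′ i (s≤s i≤j) with i ℕ.≟ j
    ... | yes ≡.refl = x , q⊆p∪q S ⁅ x ⁆ (x∈⁅x⁆ x) , newest
    ... | no  i≢j with i<j ← ℕ.≤∧≢⇒< i≤j i≢j =
      let u , u∈S , mem≡u = valid i i<j in
      u , p⊆p∪q ⁅ x ⁆ u∈S , ≡.trans (older i<j) mem≡u

  -- Simulation relation: `reaches` ties the memory to a run of the nondeterministic `Step`, which
  -- makes the final output a set that the algorithm can return. `distances` is what the next search
  -- for a farthest point relies on.
  record Round (v : Fin n) (j : ℕ) (σ : State) : Set (c ⊔ ℓ₁ ⊔ ℓ₂) where
    field
      {x m}     : ℕ
      regs      : Registers x j m σ
      S         : Subset n
      reaches   : Reaches k v S
      ∣S∣≡j     : ∣ S ∣ ≡ j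
      outputs   : Outputs j σ S
      distances : ∀ u → IsDistance u S (smem σ (toℕ u))

  exec-round : ∀ {v j σ} → j ℕ.< k → Round v j σ →
    Exec σ (findFarthest ⨾ addPoint ⨾ forEachPoint updateDistance)
      ((4 ℕ.+ n ℕ.* 6) ℕ.+ (2 ℕ.+ (2 ℕ.+ n ℕ.* 10))) (Round v (suc j))
  exec-round {v} {j} {σ} j<k round =
    exec-findFarthest v regs exec-⨾ λ (x , regs , mem≡ , smem≡ , maximal) →
    exec-addPoint regs exec-⨾ λ (regs , mem≡′ , smem≡′) →
    exec-map
      (λ {τ} (regs , mem≡″ , distances′) →
        -- The stored values are the true distances, so a maximal entry is an admissible choice.
        let step : Step k S (S ∪ ⁅ x ⁆)
            step = ≡.subst (ℕ._< k) (≡.sym ∣S∣≡j) j<k , x ,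
                   farthest (smem σ ∘ toℕ) distances maximal , ≡.refl
        in record
          { regs      = regs
          ; S         = S ∪ ⁅ x ⁆
          ; reaches   = reaches ◅◅ (step ◅ stop)
          ; ∣S∣≡j     = ≡.trans (∣step∣ step) (≡.cong suc ∣S∣≡j)
          ; outputs   = outputs-∪⁅⁆ {σ = σ} {τ} (≡.trans mem≡″ (≡.trans mem≡′ (≡.cong (_[ j ↦ toℕ x ]) mem≡))) outputs
          ; distances = distances′
          })
      (exec-forEachPoint {x = x} {Pre = λ u → IsDistance u S} {Post = λ u → IsDistance u (S ∪ ⁅ x ⁆)}
        (λ u r₄≡u r₂≡x dist → exec-map
          (λ (s′ , τ≡ , s′₀≈) → s′ , τ≡ , distance-resp-≈ (sym s′₀≈) (distance-∪⁅⁆ x dist))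
          (exec-updateDistance u x r₄≡u r₂≡x))
        regs
        (λ u → ≡.subst (IsDistance u S) (≡.sym (≡.cong-app (≡.trans smem≡′ smem≡) (toℕ u))) (distances u)))
    where open Round round

  exec-greedy : ∀ v → Exec (initial k v) greedy
    (2 ℕ.+ ((2 ℕ.+ n ℕ.* 7) ℕ.+ suc ((k ℕ.∸ 1) ℕ.* suc ((4 ℕ.+ n ℕ.* 6) ℕ.+ (2 ℕ.+ (2 ℕ.+ n ℕ.* 10))))))
    (Round v k)
  exec-greedy v =
    exec-addPoint (registers {x = toℕ v} ≡.refl ≡.refl ≡.refl ≡.refl ≡.refl) exec-⨾ λ (regs , mem≡ , _) →
    -- `Pre` is trivial because this pass overwrites every cell without reading it.
    exec-forEachPoint {x = v} {Pre = λ _ _ → Level.Lift _ Unit} {Post = λ u → IsDistance u ⁅ v ⁆}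
      (λ u r₄≡u r₂≡x _ → exec-map
        (λ (s′ , τ≡ , s′₀≈) → s′ , τ≡ , distance-resp-≈ (sym s′₀≈) (distance-⁅⁆ _ v))
        (exec-evalDistance u v r₄≡u r₂≡x))
      regs (λ _ → _) exec-⨾ λ {τ} (regs , mem≡′ , distances) →
    exec-for (Round v) (λ round → Registers.r₃ (Round.regs round) , Registers.r₁ (Round.regs round))
      -- One point is already chosen, so the loop starts at 1 and `k ∸ 1` rounds remain.
      exec-round (k ℕ.∸ 1) (ℕ.m∸n+n≡m (ℕ.<⇒≤ 2≤k)) record
        { regs      = regs
        ; S         = ⁅ v ⁆
        ; reaches   = stop
        ; ∣S∣≡j     = ∣⁅x⁆∣≡1 v
        ; outputs   = outputs-⁅⁆ {σ = τ} (≡.trans (≡.cong-app mem≡′ 0) (≡.cong-app mem≡ 0))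
        ; distances = distances
        }

  implementation : ∀ v → ∃[ t ] ∃[ σ ] ∃[ S ]
    (initial k v ⊢ greedy ⇓[ t ] σ) × t ℕ.≤ 25 ℕ.* (k ℕ.* n) × Outputs k σ S × Returns k v S
  implementation v =
    _ , _ , S , run , ℕ.≤-trans bounded (running-time 2≤k (ℕ.≤-<-trans z≤n (Fin.toℕ<n v))) ,
    outputs , reaches , ℕ.<-irrefl ∣S∣≡j
    where
    open Exec (exec-greedy v)
    open Round post

-- The star on which the bound is attained.

module Star-instance {c ℓ₁ ℓ₂} (F : OrderedField c ℓ₁ ℓ₂)
  {ε : OrderedField.Carrier F} (0≤ε : OrderedField._≤_ F (OrderedField.0# F) ε) where
  open OrderedField F
  open OrderedFieldProperties F
  open Diversity F

  0≤1+ε : 0# ≤ 1# + ε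
  0≤1+ε = +-nonNegative 0≤1 0≤ε

  0≤2+ε : 0# ≤ 2# + ε
  0≤2+ε = proj₁ (0<2+ε 0≤ε)

  1≤1+ε : 1# ≤ 1# + ε
  1≤1+ε = x≤x+y 0≤ε

  1+ε≤2+ε : 1# + ε ≤ 2# + ε
  1+ε≤2+ε = +-monoˡ-≤ ε (x≤y+x 0≤1)

  x≤[1+ε]*x : ∀ {x} → 0# ≤ x → x ≤ (1# + ε) * x
  x≤[1+ε]*x {x} 0≤x = ≤-respˡ-≈ (*-identityʳ x) (≤-respʳ-≈ (*-comm x (1# + ε)) (*-monoʳ-≤ 0≤x 1≤1+ε))

  -- `2# + ε` is the length of the detour through the centre: `1# + ε` inwards and `1#` outwards. It
  -- is the largest value that the triangle inequality allows.
  leafDistance : ∀ {k} → Fin k → Fin k → Carrier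
  leafDistance i j with i Fin.≟ j
  ... | yes _ = 0#
  ... | no  _ = 2# + ε

  leaf-nonNegative : ∀ {k} (i j : Fin k) → 0# ≤ leafDistance i j
  leaf-nonNegative i j with i Fin.≟ j
  ... | yes _ = ≤-refl
  ... | no  _ = 0≤2+ε

  leaf≤2+ε : ∀ {k} (i j : Fin k) → leafDistance i j ≤ 2# + ε
  leaf≤2+ε i j with i Fin.≟ j
  ... | yes _ = 0≤2+ε
  ... | no  _ = ≤-refl

  leaf-reflexive : ∀ {k} (i : Fin k) → leafDistance i i ≈ 0#
  leaf-reflexive i with i Fin.≟ i
  ... | yes _   = refl
  ... | no  i≢i = contradiction ≡.refl i≢i

  leaf-distinct : ∀ {k} {i j : Fin k} → i ≢ j → leafDistance i j ≡ 2# + ε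
  leaf-distinct {i = i} {j} i≢j with i Fin.≟ j
  ... | yes i≡j = contradiction i≡j i≢j
  ... | no  _   = ≡.refl

  leaf-symmetric : ∀ {k} (i j : Fin k) → leafDistance i j ≡ leafDistance j i
  leaf-symmetric i j with i Fin.≟ j | j Fin.≟ i
  ... | yes _   | yes _   = ≡.refl
  ... | yes i≡j | no  j≢i = contradiction (≡.sym i≡j) j≢i
  ... | no  i≢j | yes j≡i = contradiction (≡.sym j≡i) i≢j
  ... | no  _   | no  _   = ≡.refl

  leaf-triangle : ∀ {k} (i j l : Fin k) → leafDistance i j ≤ leafDistance i l + leafDistance l j
  leaf-triangle i j l with i Fin.≟ l
  ... | yes ≡.refl = x≤y+x ≤-refl
  ... | no  _      = ≤-trans (leaf≤2+ε i j) (x≤x+y (leaf-nonNegative l j))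

  -- The point zero is the centre; through it runs a shortest path between any two leaves.
  distance : ∀ {k} → Fin (suc k) → Fin (suc k) → Carrier
  distance zero    zero    = 0#
  distance zero    (suc _) = 1#
  distance (suc _) zero    = 1# + ε
  distance (suc i) (suc j) = leafDistance i j

  distance-nonNegative : ∀ {k} (u v : Fin (suc k)) → 0# ≤ distance u v
  distance-nonNegative zero    zero    = ≤-refl
  distance-nonNegative zero    (suc _) = 0≤1
  distance-nonNegative (suc _) zero    = 0≤1+ε
  distance-nonNegative (suc i) (suc j) = leaf-nonNegative i j

  distance≤2+ε : ∀ {k} (u v : Fin (suc k)) → distance u v ≤ 2# + ε
  distance≤2+ε zero    zero    = 0≤2+ε
  distance≤2+ε zero    (suc _) = ≤-trans 1≤1+ε 1+ε≤2+ε
  distance≤2+ε (suc _) zero    = 1+ε≤2+ε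
  distance≤2+ε (suc i) (suc j) = leaf≤2+ε i j

  distance-triangle : ∀ {k} (u v w : Fin (suc k)) → distance u v ≤ distance u w + distance w v
  distance-triangle zero    zero    w       = +-nonNegative (distance-nonNegative zero w) (distance-nonNegative w zero)
  distance-triangle zero    (suc j) zero    = x≤y+x ≤-refl
  distance-triangle zero    (suc j) (suc l) = x≤x+y (leaf-nonNegative l j)
  distance-triangle (suc i) zero    zero    = x≤x+y ≤-refl
  distance-triangle (suc i) zero    (suc l) = x≤y+x (leaf-nonNegative i l)
  distance-triangle (suc i) (suc j) zero    = ≤-respʳ-≈ 2+ε≈[1+ε]+1 (leaf≤2+ε i j)
    where
    2+ε≈[1+ε]+1 : 2# + ε ≈ (1# + ε) + 1#
    2+ε≈[1+ε]+1 = trans (+-assoc 1# 1# ε) (+-comm 1# (1# + ε))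
  distance-triangle (suc i) (suc j) (suc l) = leaf-triangle i j l

  -- Between a leaf and the centre the factor `1# + ε` is used up exactly; leaves are at symmetric
  -- distances from each other.
  distance-swap : ∀ {k} (u v : Fin (suc k)) → distance u v ≤ (1# + ε) * distance v u
  distance-swap zero    zero    = x≤[1+ε]*x ≤-refl
  distance-swap zero    (suc _) = ≤-trans 1≤1+ε (x≤[1+ε]*x 0≤1+ε)
  distance-swap (suc _) zero    = ≤-reflexive (sym (*-identityʳ (1# + ε)))
  distance-swap (suc i) (suc j) =
    ≤-respˡ-≈ (≈-reflexive (leaf-symmetric j i)) (x≤[1+ε]*x (leaf-nonNegative j i))

  space : ∀ k → AsymmetricPseudometric (suc k)
  space k = record
    { d           = distance
    ; nonNegative = distance-nonNegative
    ; reflexive   = λ { zero → refl ; (suc i) → leaf-reflexive i }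
    ; triangle    = distance-triangle
    }

  symmetric : ∀ k → AsymmetricPseudometric.IsSymmetricUpTo (space k) ε
  symmetric k u v = ⊔-lub
    (≤-*⊓ (x≤[1+ε]*x (distance-nonNegative u v)) (distance-swap u v))
    (≤-*⊓ (distance-swap v u) (x≤[1+ε]*x (distance-nonNegative v u)))
    where
    ≤-*⊓ : ∀ {x a b} → x ≤ (1# + ε) * a → x ≤ (1# + ε) * b → x ≤ (1# + ε) * (a ⊓ b)
    ≤-*⊓ {a = a} {b} x≤a x≤b = case ⊓-sel a b of λ
      { (inj₁ ≈a) → ≤-respʳ-≈ (*-congˡ (sym ≈a)) x≤a
      ; (inj₂ ≈b) → ≤-respʳ-≈ (*-congˡ (sym ≈b)) x≤b
      }

  -- Any diversity is one of the distances, hence at most `2# + ε`, and the set of all `k` leaves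
  -- attains this.
  leaves-optimal : ∀ {k} → 2 ℕ.≤ k → AsymmetricPseudometric.IsOptimum (space k) k (2# + ε)
  leaves-optimal {suc (suc k)} (s≤s (s≤s _)) =
    ( outside ∷ ⊤ , ∣⊤∣≡n (suc (suc k))
    , (suc zero , suc (suc zero) , there ∈⊤ , there ∈⊤ , (λ ()) , refl)
    , λ { x (u , w , u∈ , w∈ , u≢w , x≈d) → ≤-respʳ-≈ (sym x≈d) (leaves-far u∈ w∈ u≢w) } ) ,
    λ { x (_ , _ , (u , w , _ , _ , _ , x≈d) , _) → ≤-respˡ-≈ (sym x≈d) (distance≤2+ε u w) }
    where
    leaves-far : ∀ {u w : Fin (3 ℕ.+ k)} → u ∈ outside ∷ ⊤ → w ∈ outside ∷ ⊤ → u ≢ w → 2# + ε ≤ distance u w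
    leaves-far {suc i} {suc j} (there _) (there _) u≢w =
      ≤-reflexive (≈-reflexive (≡.sym (leaf-distinct (u≢w ∘ ≡.cong suc))))

  star : ∀ {k} → 2 ℕ.≤ k → Instance ε k
  star {k} 2≤k = record
    { n         = suc k
    ; space     = space k
    ; k≤n       = ℕ.n≤1+n k
    ; symmetric = symmetric k
    ; R*        = 2# + ε
    ; optimum   = leaves-optimal 2≤k
    ; positive  = 0<2+ε 0≤ε
    }

  module _ {k} (2≤k : 2 ℕ.≤ k) where
    open Instance (star 2≤k) using (IsDiv; Returns; R*)
    open Greedy F 0≤ε 2≤k (star 2≤k)

    -- Of two distinct members one is a leaf, and the centre is at distance `1#` to it; the cheaper
    -- direction, outwards, counts.
    centre∈S⇒div≤1 : ∀ {S D} → zero ∈ S → 2 ℕ.≤ ∣ S ∣ → IsDiv S D → D ≤ 1#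
    centre∈S⇒div≤1 {S} 0∈S 2≤∣S∣ (_ , minimal) with distinct-∈ S 2≤∣S∣
    ... | suc i , _     , i∈S , _   , _   = minimal 1# (zero , suc i , 0∈S , i∈S , (λ ()) , refl)
    ... | zero  , suc j , _   , j∈S , _   = minimal 1# (zero , suc j , 0∈S , j∈S , (λ ()) , refl)
    ... | zero  , zero  , _   , _   , 0≢0 = contradiction ≡.refl 0≢0

    -- Here `R*` equals `2# + ε`, so the quotient is `1#`. The centre is the starting point and
    -- stays selected, so the bound holds however ties are broken.
    tightness : ∀ {S} → Returns k zero S → ∃[ D ] IsDiv S D × D ≤ R* / (2# + ε)
    tightness returns@(reaches , _) with returns⇒∃-div {zero} returns
    ... | D , isDiv = D , isDiv ,
      ≤-respʳ-≈ (sym (⁻¹-inverseʳ (2# + ε) (0<⇒≉0 (0<2+ε 0≤ε))))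
        (centre∈S⇒div≤1 (Invariant.v∈S (reaches-invariant reaches))
          (≡.subst (2 ℕ.≤_) (≡.sym (returns⇒∣S∣≡k {zero} returns)) 2≤k) isDiv)

theorem4p1 : ∀ {c ℓ₁ ℓ₂} (F : OrderedField c ℓ₁ ℓ₂) →
  let open OrderedField F
      open Diversity F
  in
  -- approximation guarantee
  (∀ ε → 0# ≤ ε → ∀ k → 2 ℕ.≤ k → (I : Instance ε k) →
    let open Instance I in
    ∀ v → AlwaysTerminates k v ×
      (∀ S → Returns k v S →
        ∣ S ∣ ≡ k × (∃[ D ] IsDiv S D × R* / (2# + ε) ≤ D)))
  ×
  -- implementation in time O(kn)
  (Σ[ p ∈ Program ] Σ[ C ∈ ℕ ]
    (∀ ε → 0# ≤ ε → ∀ k → 2 ℕ.≤ k → (I : Instance ε k) →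
      let open Instance I
          open Semantics space
      in
      ∀ v → ∃[ t ] ∃[ σ ] ∃[ S ]
        (initial k v ⊢ p ⇓[ t ] σ) × t ℕ.≤ C ℕ.* (k ℕ.* n) ×
        Outputs k σ S × Returns k v S))
  ×
  -- tightness
  (∀ ε → 0# ≤ ε → ∀ k → 2 ℕ.≤ k → Σ[ I ∈ Instance ε k ]
    (let open Instance I in
     ∃[ v ] (∃[ S ] Returns k v S) ×
       (∀ S → Returns k v S →
         ∃[ D ] IsDiv S D × D ≤ R* / (2# + ε))))
theorem4p1 F =
  (λ ε 0≤ε k 2≤k I v → let open Greedy F 0≤ε 2≤k I in
    alwaysTerminates v , λ S returns → returns⇒∣S∣≡k returns , approximation returns) ,
  (greedy , 25 , λ ε 0≤ε k 2≤k I → Implementation.implementation F 0≤ε 2≤k I) ,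
  (λ ε 0≤ε k 2≤k → let open Star-instance F 0≤ε in
    star 2≤k , zero , Greedy.∃-returns F 0≤ε 2≤k (star 2≤k) zero , λ S → tightness 2≤k)
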